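{- The calculus RK is cut-free complete for the modal logic K: for every hypersequent $H$, if $H$ is valid in the class of all frames (i.e., there is no counter-example to $H$), then $H$ has a derivation in RK that does not use the Cut rule.
   Context: **Language.** Modal formulas are built from propositional variables by $\lnot,\land,\Box$. A frame is $\langle W,R\rangle$ with $W\neq\emptyset$, $R\subseteq W\times W$; a model $\mathfrak M=\langle W,R,V\rangle$ adds a valuation, and truth $\mathfrak M,w\models\varphi$ is the usual Kripke truth definition ($\Box\varphi$ is true at $w$ iff $\varphi$ is true at every $v$ with $wRv$). **Hypersequents.** A sequent is an expression $\Gamma\Rightarrow\Delta$ with $\Gamma,\Delta$ finite sets of formulas (written as comma-separated lists; $\varphi,\Gamma$ means $\{\varphi\}\cup\Gamma$, and $\varphi\in\Gamma$ is allowed). A hypersequent is a finite nonempty sequence of sequents $S_1\;/\!/\;\dots\;/\!/\; S_n$ (order and multiplicity matter). **Semantics.** $\mathfrak M$ is a countermodel to $\Gamma\Rightarrow\Delta$ at $w$ iff $\mathfrak M,w\models\varphi$ for all $\varphi\in\Gamma$ and $\mathfrak M,w\not\models\psi$ for all $\psi\in\Delta$. $\mathfrak M$ is a counter-example to $\Gamma_1\Rightarrow\Delta_1\;/\!/\;\dots\;/\!/\;\Gamma_n\Rightarrow\Delta_n$ iff there are worlds $w_1,\dots,w_n$ with $w_iRw_{i+1}$ for $1\le i<n$ such that $\mathfrak M$ is a countermodel to $\Gamma_i\Rightarrow\Delta_i$ at $w_i$ for every $i$. A hypersequent is valid in a class of frames iff no model based on a frame in the class is a counter-example to it. **The calculus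 RK.** Derivations are finite trees of hypersequents whose leaves are axioms $\varphi\Rightarrow\varphi$ (one-component hypersequents) and which are built by the following rules. Here $G,H$ are possibly empty sequences of sequents unless otherwise said; "premise(s) / conclusion". - WL: $G\;/\!/\;\Gamma\Rightarrow\Delta\;/\!/\; H$ / $G\;/\!/\;\varphi,\Gamma\Rightarrow\Delta\;/\!/\; H$. - WR: $G\;/\!/\;\Gamma\Rightarrow\Delta\;/\!/\; H$ / $G\;/\!/\;\Gamma\Rightarrow\Delta,\varphi\;/\!/\; H$. - Cut: $G\;/\!/\;\Gamma\Rightarrow\Delta,\varphi\;/\!/\; H$ and $G\;/\!/\;\varphi,\Lambda\Rightarrow\Theta\;/\!/\; H$ / $G\;/\!/\;\Gamma,\Lambda\Rightarrow\Delta,\Theta\;/\!/\; H$. - EWR: $G$ / $G\;/\!/\;\ \Rightarrow\ $ ($G$ a hypersequent; an empty sequent is appended on the right). - EWL: $G$ / $\ \Rightarrow\ \;/\!/\; G$ ($G$ a hypersequent; an empty sequent is prepended on the left). - $\lnot$L: $G\;/\!/\;\Gamma\Rightarrow\Delta,\varphi\;/\!/\; H$ / $G\;/\!/\;\lnot\varphi,\Gamma\Rightarrow\Delta\;/\!/\; H$. - $\lnot$R: $G\;/\!/\;\varphi,\Gamma\Rightarrow\Delta\;/\!/\; H$ / $G\;/\!/\;\Gamma\Rightarrow\Delta,\lnot\varphi\;/\!/\; H$. - $\land$L$_1$: $G\;/\!/\;\varphi,\Gamma\Rightarrow\Delta\;/\!/\; H$ / $G\;/\!/\;\varphi\land\psi,\Gamma\Rightarrow\Delta\;/\!/\;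 H$. - $\land$L$_2$: $G\;/\!/\;\psi,\Gamma\Rightarrow\Delta\;/\!/\; H$ / $G\;/\!/\;\varphi\land\psi,\Gamma\Rightarrow\Delta\;/\!/\; H$. - $\land$R: $G\;/\!/\;\Gamma\Rightarrow\Delta,\varphi\;/\!/\; H$ and $G\;/\!/\;\Gamma\Rightarrow\Delta,\psi\;/\!/\; H$ / $G\;/\!/\;\Gamma\Rightarrow\Delta,\varphi\land\psi\;/\!/\; H$. - $\Box$L: $G\;/\!/\;\Gamma\Rightarrow\Delta\;/\!/\;\varphi,\Lambda\Rightarrow\Theta\;/\!/\; H$ / $G\;/\!/\;\Box\varphi,\Gamma\Rightarrow\Delta\;/\!/\;\Lambda\Rightarrow\Theta\;/\!/\; H$. - $\Box$R: $H\;/\!/\;\Gamma\Rightarrow\Delta\;/\!/\;\ \Rightarrow\varphi$ / $H\;/\!/\;\Gamma\Rightarrow\Delta,\Box\varphi$ (the active components are rightmost). -}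

module Defs where

open import Data.List.Base using (List; []; _∷_; _++_)
open import Data.List.NonEmpty.Base using (List⁺; _∷_; toList; _++⁺_; _⁺++_; _∷⁺_)
open import Data.List.Relation.Binary.BagAndSetEquality using (_∼[_]_; set)
open import Data.List.Relation.Binary.Pointwise.Base using (Pointwise)
open import Data.List.Relation.Unary.All using (All)
open import Data.List.Relation.Unary.Linked using (Linked)
open import Data.Nat.Base using (ℕ)
open import Data.Product.Base using (_×_; ∃-syntax)
open import Data.Unit.Base using (⊤)
open import Data.Empty using (⊥)
open import Level using (Level; 0ℓ)
open import Relation.Binary.Core using (Rel)
open import Relation.Nullary.Negation.Core using (¬_)
open import Relation.Unary using (Pred; _∈_)

infixr 8 □_ ∼_
infixr 7 _∧_

data Formula : Set where
  var : ℕ → Formula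
  ∼_  : Formula → Formula
  _∧_ : Formula → Formula → Formula
  □_  : Formula → Formula

infix 4 _⇒_

-- Both sides are finite sets of formulas, represented by lists;
-- order and multiplicity are discarded by _≈ˢ_ below.
record Sequent : Set where
  constructor _⇒_
  field
    antecedent : List Formula
    succedent  : List Formula

open Sequent public

Hypersequent : Set
Hypersequent = List⁺ Sequent

infix 4 _≈ˢ_ _≈ʰ_

_≈ˢ_ : Rel Sequent 0ℓ
S ≈ˢ T = (antecedent S ∼[ set ] antecedent T) × (succedent S ∼[ set ] succedent T)

_≈ʰ_ : Rel Hypersequent 0ℓ
G ≈ʰ H = Pointwise _≈ˢ_ (toList G) (toList H)

record Frame : Set₁ where
  field
    World    : Set
    R        : Rel World 0ℓ
    nonempty : World

record Model : Set₁ where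
  field
    frame : Frame
  open Frame frame public
  field
    V : ℕ → Pred World 0ℓ

open Model using (World; R; V; frame)

infix 4 _,_⊨_

_,_⊨_ : (M : Model) → World M → Formula → Set
M , w ⊨ var p = w ∈ V M p
M , w ⊨ ∼ φ   = ¬ (M , w ⊨ φ)
M , w ⊨ φ ∧ ψ = (M , w ⊨ φ) × (M , w ⊨ ψ)
M , w ⊨ □ φ   = ∀ v → R M w v → M , v ⊨ φ

CountermodelAt : (M : Model) → World M → Sequent → Set
CountermodelAt M w (Γ ⇒ Δ) =
  All (λ φ → M , w ⊨ φ) Γ × All (λ ψ → ¬ (M , w ⊨ ψ)) Δ

CounterExample : Model → Hypersequent → Set
CounterExample M H =
  ∃[ ws ] (Linked (R M) ws × Pointwise (CountermodelAt M) ws (toList H))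

ValidIn : {ℓ : Level} → Pred Frame ℓ → Hypersequent → Set _
ValidIn C H = (M : Model) → frame M ∈ C → ¬ CounterExample M H

private
  variable
    φ ψ     : Formula
    Γ Δ Λ Θ : List Formula
    G H     : List Sequent
    K L     : Hypersequent

-- G and H are possibly empty contexts, K and L are hypersequents.
data RK : Hypersequent → Set where
  -- Not an inference: lists with the same elements denote the same set.
  resp : K ≈ʰ L → RK K → RK L

  ax  : RK ((φ ∷ [] ⇒ φ ∷ []) ∷ [])

  WL  : RK (G ++⁺ ((Γ ⇒ Δ) ∷ H)) →
        RK (G ++⁺ ((φ ∷ Γ ⇒ Δ) ∷ H))
  WR  : RK (G ++⁺ ((Γ ⇒ Δ) ∷ H)) →
        RK (G ++⁺ ((Γ ⇒ φ ∷ Δ) ∷ H))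
  Cut : RK (G ++⁺ ((Γ ⇒ φ ∷ Δ) ∷ H)) →
        RK (G ++⁺ ((φ ∷ Λ ⇒ Θ) ∷ H)) →
        RK (G ++⁺ ((Γ ++ Λ ⇒ Δ ++ Θ) ∷ H))

  EWR : RK K → RK (K ⁺++ (([] ⇒ []) ∷ []))
  EWL : RK K → RK (([] ⇒ []) ∷⁺ K)

  ¬L  : RK (G ++⁺ ((Γ ⇒ φ ∷ Δ) ∷ H)) →
        RK (G ++⁺ ((∼ φ ∷ Γ ⇒ Δ) ∷ H))
  ¬R  : RK (G ++⁺ ((φ ∷ Γ ⇒ Δ) ∷ H)) →
        RK (G ++⁺ ((Γ ⇒ ∼ φ ∷ Δ) ∷ H))

  ∧L₁ : RK (G ++⁺ ((φ ∷ Γ ⇒ Δ) ∷ H)) →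
        RK (G ++⁺ ((φ ∧ ψ ∷ Γ ⇒ Δ) ∷ H))
  ∧L₂ : RK (G ++⁺ ((ψ ∷ Γ ⇒ Δ) ∷ H)) →
        RK (G ++⁺ ((φ ∧ ψ ∷ Γ ⇒ Δ) ∷ H))
  ∧R  : RK (G ++⁺ ((Γ ⇒ φ ∷ Δ) ∷ H)) →
        RK (G ++⁺ ((Γ ⇒ ψ ∷ Δ) ∷ H)) →
        RK (G ++⁺ ((Γ ⇒ φ ∧ ψ ∷ Δ) ∷ H))

  □L  : RK (G ++⁺ ((Γ ⇒ Δ) ∷ (φ ∷ Λ ⇒ Θ) ∷ H)) →
        RK (G ++⁺ ((□ φ ∷ Γ ⇒ Δ) ∷ (Λ ⇒ Θ) ∷ H))
  □R  : RK (H ++⁺ ((Γ ⇒ Δ) ∷ ([] ⇒ φ ∷ []) ∷ [])) →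
        RK (H ++⁺ ((Γ ⇒ □ φ ∷ Δ) ∷ []))

CutFree : RK K → Set
CutFree (resp _ d) = CutFree d
CutFree ax         = ⊤
CutFree (WL d)     = CutFree d
CutFree (WR d)     = CutFree d
CutFree (Cut _ _)  = ⊥
CutFree (EWR d)    = CutFree d
CutFree (EWL d)    = CutFree d
CutFree (¬L d)     = CutFree d
CutFree (¬R d)     = CutFree d
CutFree (∧L₁ d)    = CutFree d
CutFree (∧L₂ d)    = CutFree d
CutFree (∧R d e)   = CutFree d × CutFree e
CutFree (□L d)     = CutFree d
CutFree (□R d)     = CutFree d

{-# OPTIONS --safe #-}

-- Every hypersequent S // Hs is either cut-free derivable or has a
-- counter-example in one fixed model whose worlds are finite trees labelled
-- with atoms.  The propositional rules, read backwards on S, are invertible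
-- and reduce S to □B, A ⇒ □D, C with A and C atoms.  If A and C are disjoint,
-- a tree labelled A refutes S provided that each of its children satisfies B
-- and that each φ ∈ D fails at some child.  So search for refutations of B ⇒ φ
-- for φ ∈ D, and, when Hs is Γ ⇒ Δ // Hs', for one of B, Γ ⇒ Δ // Hs', whose
-- first world becomes a further child.  If one of these is derivable
-- instead, then prepending the empty sequent (EWL) and moving B to the left
-- by □L yields, with □R and weakening, a derivation of S // Hs.

module Submission where

open import Defs
open import Data.List.Base using (List; []; _∷_; _++_; map)
open import Data.List.Membership.DecPropositional using (_∈?_)
open import Data.List.Membership.Propositional using (_∈_; lose; find)
open import Data.List.Membership.Propositional.Properties using (∈-++⁻; ∈-map⁺)
open import Data.List.NonEmpty.Base using (_∷_; _∷⁺_; _++⁺_; _⁺++_)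
open import Data.List.Properties using (++-identityʳ; map-++)
open import Data.List.Relation.Binary.BagAndSetEquality using (_∼[_]_; set)
open import Data.List.Relation.Binary.Permutation.Propositional
  using (_↭_; ↭-refl; ↭-trans; ↭-reflexive)
open import Data.List.Relation.Binary.Permutation.Propositional.Properties
  using (shift; ∈-resp-↭; All-resp-↭)
  renaming (++⁺ˡ to ↭-++⁺ˡ)
open import Data.List.Relation.Binary.Pointwise.Base using ([]; _∷_)
import Data.List.Relation.Binary.Pointwise.Properties as Pointwise
open import Data.List.Relation.Binary.Subset.Propositional using (_⊆_)
open import Data.List.Relation.Binary.Subset.Propositional.Properties
  using (⊆-refl; xs⊆xs++ys; xs⊆ys++xs)
open import Data.List.Relation.Unary.All as All using (All; []; _∷_)
import Data.List.Relation.Unary.All.Properties as All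
open import Data.List.Relation.Unary.Any using (Any; here; there; any?)
open import Data.List.Relation.Unary.Linked using ([-]; _∷_)
open import Data.Nat.Base using (ℕ; suc; _+_; _≤_; _<_; s≤s)
open import Data.Nat.Induction using (<-wellFounded)
open import Data.Nat.ListAction using (sum)
open import Data.Nat.ListAction.Properties using (sum-++)
open import Data.Nat.Properties
  using (_≟_; ≤-refl; ≤-reflexive; ≤-trans; m≤m+n; m≤n+m; n≤1+n; +-monoʳ-≤; +-monoˡ-≤; module ≤-Reasoning)
open import Data.Nat.Tactic.RingSolver using (solve-∀)
open import Data.Product.Base using (Σ-syntax; ∃-syntax; _×_; _,_; proj₁; proj₂)
open import Data.Sum.Base as Sum using (_⊎_; inj₁; inj₂)
open import Data.Unit.Base using (⊤; tt)
open import Function.Base using (_∘_; id)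
open import Function.Bundles using (mk⇔)
open import Induction.WellFounded using (Acc; acc)
open import Relation.Binary.PropositionalEquality using (_≡_; refl; sym; trans; cong; subst)
open import Relation.Nullary.Decidable using (yes; no)
open import Relation.Nullary.Negation.Core using (¬_; contradiction)
open import Relation.Unary using (U)

private
  variable
    p         : ℕ
    φ ψ       : Formula
    Γ Δ Γ′ Δ′ : List Formula
    S T       : Sequent
    Hs        : List Sequent

-- Cut-free derivations and weakening.

Derivable : Hypersequent → Set
Derivable K = Σ[ d ∈ RK K ] CutFree d

resp⊢ : ∀ {K L} → K ≈ʰ L → Derivable K → Derivable L
resp⊢ eq (d , c) = resp eq d , c

≈ˢ-refl : S ≈ˢ S
≈ˢ-refl = mk⇔ id id , mk⇔ id id

replace-≈ʰ : ∀ G → S ≈ˢ T → (G ++⁺ (S ∷ Hs)) ≈ʰ (G ++⁺ (T ∷ Hs))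
replace-≈ʰ []      eq = eq ∷ Pointwise.refl ≈ˢ-refl
replace-≈ʰ (_ ∷ G) eq = ≈ˢ-refl ∷ replace-≈ʰ G eq

weaken-++ : ∀ G Λ Θ → Derivable (G ++⁺ ((Γ ⇒ Δ) ∷ Hs)) →
            Derivable (G ++⁺ ((Λ ++ Γ ⇒ Θ ++ Δ) ∷ Hs))
weaken-++ G [] []      d = d
weaken-++ G [] (ψ ∷ Θ) d = let (d , c) = weaken-++ G [] Θ d in WR {G = G} d , c
weaken-++ G (φ ∷ Λ) Θ  d = let (d , c) = weaken-++ G Λ Θ d in WL {G = G} d , c

-- `WL` and `WR` add all of `Γ′` and `Δ′`; the old formulas are then duplicates, which `resp`
-- absorbs because sides are compared as sets. Exchange and contraction are thus covered too.
weaken : ∀ G → Γ ⊆ Γ′ → Δ ⊆ Δ′ → Derivable (G ++⁺ ((Γ ⇒ Δ) ∷ Hs)) →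
         Derivable (G ++⁺ ((Γ′ ⇒ Δ′) ∷ Hs))
weaken G Γ⊆Γ′ Δ⊆Δ′ =
  resp⊢ (replace-≈ʰ G (absorb Γ⊆Γ′ , absorb Δ⊆Δ′)) ∘ weaken-++ G _ _
  where
  absorb : Γ ⊆ Δ → (Δ ++ Γ) ∼[ set ] Δ
  absorb {Γ} {Δ} Γ⊆Δ = mk⇔ (Sum.[ id , Γ⊆Δ ] ∘ ∈-++⁻ Δ) (xs⊆xs++ys Δ Γ)

++⁺-⁺++ : ∀ G (S T : Sequent) → (G ++⁺ (S ∷ [])) ⁺++ (T ∷ []) ≡ (G ++ S ∷ []) ++⁺ (T ∷ [])
++⁺-⁺++ []      S T = refl
++⁺-⁺++ (_ ∷ G) S T = cong (_ ∷⁺_) (++⁺-⁺++ G S T)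

++⁺-snoc : ∀ G (S T : Sequent) Hs → (G ++ S ∷ []) ++⁺ (T ∷ Hs) ≡ G ++⁺ (S ∷ T ∷ Hs)
++⁺-snoc []      S T Hs = refl
++⁺-snoc (_ ∷ G) S T Hs = cong (_ ∷⁺_) (++⁺-snoc G S T Hs)

-- `EWR` reaches only the right end, so each new sequent is appended empty and filled by weakening;
-- it then becomes the last component, while `S` joins the prefix.
extendʳ : ∀ G S Hs → Derivable (G ++⁺ (S ∷ [])) → Derivable (G ++⁺ (S ∷ Hs))
extendʳ G S []       d       = d
extendʳ G S (T ∷ Hs) (d , c) =
  subst Derivable (++⁺-snoc G S T Hs)
    (extendʳ (G ++ S ∷ []) T Hs
      (weaken (G ++ S ∷ []) (λ ()) (λ ())
        (subst Derivable (++⁺-⁺++ G S ([] ⇒ [])) (EWR d , c))))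

ax⊢ : φ ∈ Γ → φ ∈ Δ → Derivable ((Γ ⇒ Δ) ∷ Hs)
ax⊢ i j = weaken [] (λ { (here refl) → i }) (λ { (here refl) → j }) (extendʳ [] _ _ (ax , tt))

□L⋆ : ∀ Λ → Derivable ((Γ ⇒ Δ) ∷ (Λ ++ Γ′ ⇒ Δ′) ∷ Hs) →
      Derivable ((map □_ Λ ++ Γ ⇒ Δ) ∷ (Γ′ ⇒ Δ′) ∷ Hs)
□L⋆ [] d = d
□L⋆ {Γ} (φ ∷ Λ) (d , c) =
  weaken [] (∈-resp-↭ (shift (□ φ) (map □_ Λ) Γ)) ⊆-refl (□L⋆ Λ (□L {G = []} d , c))

-- The tree model and search results.

data Tree : Set where
  node : List ℕ → List Tree → Tree

label : Tree → List ℕ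
label (node A _) = A

children : Tree → List Tree
children (node _ ts) = ts

-- Truth at a tree depends only on that tree and its subtrees, so trees found by separate searches
-- can be hung below a new root with no truth to transfer between models.
treeModel : Model
treeModel = record
  { frame = record
    { World    = Tree
    ; R        = λ t u → u ∈ children t
    ; nonempty = node [] []
    }
  ; V = λ p t → p ∈ label t
  }

_⊩_ : Tree → Formula → Set
t ⊩ φ = treeModel , t ⊨ φ

Refutes : Tree → Sequent → Set
Refutes = CountermodelAt treeModel

Result : Sequent → List Sequent → Set
Result S Hs = Derivable (S ∷ Hs) ⊎ CounterExample treeModel (S ∷ Hs)

mapCounterExample : (∀ {t} → Refutes t S → Refutes t T) →
                    CounterExample treeModel (S ∷ Hs) → CounterExample treeModel (T ∷ Hs)
mapCounterExample f (t ∷ ts , linked , c ∷ cs) = t ∷ ts , linked , f c ∷ cs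

-- The first argument is a rule read forwards, the second its invertibility. Only the first sequent
-- changes, so the path of worlds is kept.
mapResult : (Derivable (S ∷ Hs) → Derivable (T ∷ Hs)) → (∀ {t} → Refutes t S → Refutes t T) →
            Result S Hs → Result T Hs
mapResult f g = Sum.map f (mapCounterExample g)

permute : Γ ↭ Γ′ → Δ ↭ Δ′ → Result (Γ ⇒ Δ) Hs → Result (Γ′ ⇒ Δ′) Hs
permute Γ↭Γ′ Δ↭Δ′ = mapResult
  (weaken [] (∈-resp-↭ Γ↭Γ′) (∈-resp-↭ Δ↭Δ′))
  (λ (l , r) → All-resp-↭ Γ↭Γ′ l , All-resp-↭ Δ↭Δ′ r)

drop-++[] : Result (Γ ++ [] ⇒ Δ ++ []) Hs → Result (Γ ⇒ Δ) Hs
drop-++[] = permute (↭-reflexive (++-identityʳ _)) (↭-reflexive (++-identityʳ _))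

-- Invertible propositional rules.

∼ˡ : Result (Γ ⇒ φ ∷ Δ) Hs → Result (∼ φ ∷ Γ ⇒ Δ) Hs
∼ˡ = mapResult (λ (d , c) → ¬L {G = []} d , c) λ { (l , f ∷ r) → f ∷ l , r }

∼ʳ : Result (φ ∷ Γ ⇒ Δ) Hs → Result (Γ ⇒ ∼ φ ∷ Δ) Hs
∼ʳ = mapResult (λ (d , c) → ¬R {G = []} d , c) λ { (x ∷ l , r) → l , (λ f → f x) ∷ r }

∧ˡ : Result (φ ∷ ψ ∷ Γ ⇒ Δ) Hs → Result (φ ∧ ψ ∷ Γ ⇒ Δ) Hs
∧ˡ {φ} {ψ} {Γ} = mapResult derive λ { (x ∷ y ∷ l , r) → (x , y) ∷ l , r }
  where
  derive : Derivable ((φ ∷ ψ ∷ Γ ⇒ Δ) ∷ Hs) → Derivable ((φ ∧ ψ ∷ Γ ⇒ Δ) ∷ Hs)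
  derive (d , c) =
    -- `∧L₁` and `∧L₂` each turn one conjunct into `φ ∧ ψ`; the last weakening contracts the two
    -- copies.
    let (e , c′) = weaken [] (∈-resp-↭ (shift ψ (φ ∧ ψ ∷ []) Γ)) ⊆-refl (∧L₁ {G = []} {ψ = ψ} d , c)
    in weaken [] (λ { (here i) → here i ; (there i) → i }) ⊆-refl (∧L₂ {G = []} {φ = φ} e , c′)

∧ʳ : Result (Γ ⇒ φ ∷ Δ) Hs → Result (Γ ⇒ ψ ∷ Δ) Hs → Result (Γ ⇒ φ ∧ ψ ∷ Δ) Hs
∧ʳ (inj₁ (d , c)) (inj₁ (e , c′)) = inj₁ (∧R {G = []} d e , c , c′)
∧ʳ (inj₂ m) _ = inj₂ (mapCounterExample (λ { (l , f ∷ r) → l , f ∘ proj₁ ∷ r }) m)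
∧ʳ _ (inj₂ m) = inj₂ (mapCounterExample (λ { (l , f ∷ r) → l , f ∘ proj₂ ∷ r }) m)

-- The modal step.

literals : List ℕ → List Formula → List Formula
literals A B = map □_ B ++ map var A

var-shift : ∀ Γ A B → Γ ++ literals (p ∷ A) B ↭ var p ∷ Γ ++ literals A B
var-shift Γ A B =
  ↭-trans (↭-++⁺ˡ Γ (shift _ (map □_ B) (map var A))) (shift _ Γ (literals A B))

-- Each `φ` gets a tree of its own, refuting `B ⇒ φ`. All these trees satisfy `B`, so collecting
-- them as siblings does no harm.
successors : ∀ B D → (∀ {φ} → φ ∈ D → Result (B ⇒ φ ∷ []) []) →
             (∃[ φ ] φ ∈ D × Derivable ((B ⇒ φ ∷ []) ∷ [])) ⊎
             (∃[ ts ] All (λ t → All (t ⊩_) B) ts × All (λ φ → Any (λ t → ¬ t ⊩ φ) ts) D)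
successors B []      f = inj₂ ([] , [] , [])
successors B (φ ∷ D) f with f (here refl) | successors B D (f ∘ there)
... | inj₁ d | _ = inj₁ (φ , here refl , d)
... | inj₂ _ | inj₁ (ψ , i , d) = inj₁ (ψ , there i , d)
... | inj₂ (t ∷ [] , _ , (l , f ∷ []) ∷ []) | inj₂ (ts , sat , ref) =
  inj₂ (t ∷ ts , l ∷ sat , here f ∷ All.map there ref)

refutes-literals : ∀ {A B C D ts} → ¬ Any (_∈ A) C → All (λ t → All (t ⊩_) B) ts →
                   All (λ φ → Any (λ t → ¬ t ⊩ φ) ts) D →
                   Refutes (node A ts) (literals A B ⇒ literals C D)
refutes-literals disjoint sat ref =
  All.++⁺ (All.map⁺ (All.tabulate λ i t j → All.lookup (All.lookup sat j) i)) (All.map⁺ (All.tabulate id)) ,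
  All.++⁺ (All.map⁺ (All.map (λ k f → let (t , i , ¬φ) = find k in ¬φ (f t i)) ref))
      (All.map⁺ (All.tabulate λ i j → disjoint (lose i j)))

□-derivable : ∀ {A B C D} → φ ∈ D → Derivable ((B ⇒ φ ∷ []) ∷ []) →
              Derivable ((literals A B ⇒ literals C D) ∷ Hs)
□-derivable {A = A} {B} {C} {D} i (d , c) =
  let (e , c′) = □L⋆ B (subst (λ Λ → Derivable (([] ⇒ []) ∷ (Λ ⇒ _) ∷ []))
                   (sym (++-identityʳ B)) (EWL d , c))
  in weaken []
       (subst (_⊆ literals A B) (sym (++-identityʳ _)) (xs⊆xs++ys _ _))
       (λ { (here refl) → xs⊆xs++ys _ _ (∈-map⁺ □_ i) })
       -- `□R` acts on the rightmost component, so `Hs` is appended only after it.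
       (extendʳ [] _ _ (□R {H = []} e , c′))

-- The world refuting the next sequent is a child of the current one, so it must satisfy `B` as
-- well.
Next : List Formula → List Sequent → Set
Next B []             = ⊤
Next B ((Γ ⇒ Δ) ∷ Hs) = Result (B ++ Γ ⇒ Δ) Hs

modal : ∀ A B C D Hs → (∀ {φ} → φ ∈ D → Result (B ⇒ φ ∷ []) []) → Next B Hs →
        Result (literals A B ⇒ literals C D) Hs
modal A B C D Hs succ next with any? (λ p → _∈?_ _≟_ p A) C
... | yes k = let (p , i , j) = find k in
  inj₁ (ax⊢ (xs⊆ys++xs _ (map □_ B) (∈-map⁺ var j)) (xs⊆ys++xs _ (map □_ D) (∈-map⁺ var i)))
... | no disjoint with successors B D succ
...   | inj₁ (φ , i , d) = inj₁ (□-derivable i d)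
...   | inj₂ (ts , sat , ref) = link Hs next
  where
  link : ∀ Hs → Next B Hs → Result (literals A B ⇒ literals C D) Hs
  link [] tt = inj₂ (_ , [-] , refutes-literals disjoint sat ref ∷ [])
  link (_ ∷ _) (inj₁ (d , c)) =
    inj₁ (weaken [] (subst (_⊆ literals A B) (sym (++-identityʳ _)) (xs⊆xs++ys _ _)) (λ ())
      (□L⋆ B (EWL d , c)))
  -- The first world `t` of the path found becomes an extra first child, which links the new root to
  -- the path; `All.map there` shifts the other witnesses past it.
  link (_ ∷ _) (inj₂ (t ∷ _ , linked , (l , r) ∷ cs)) =
    inj₂ (_ , here refl ∷ linked ,
          refutes-literals disjoint (All.++⁻ˡ B l ∷ sat) (All.map there ref) ∷
          (All.++⁻ʳ B l , r) ∷ cs)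

-- The termination measure.

-- □ weighs two so that a sequent gets lighter when □ φ is moved to D, where φ
-- weighs 1 + size φ, and again when B ⇒ φ is searched.
size : Formula → ℕ
size (var _) = 1
size (∼ φ)   = suc (size φ)
size (φ ∧ ψ) = suc (size φ + size ψ)
size (□ φ)   = suc (suc (size φ))

sizes : List Formula → ℕ
sizes Γ = sum (map size Γ)

-- The extra unit pays for passing to the next component, even when that component and `D` are
-- empty.
sequentSize : Sequent → ℕ
sequentSize (Γ ⇒ Δ) = suc (sizes Γ + sizes Δ)

-- The atoms in `A` and `C` are finished, but `B` still counts because its formulas are decomposed
-- again at the children.
weight : (Γ Δ B D : List Formula) → List Sequent → ℕ
weight Γ Δ B D Hs =
  sizes Γ + (sizes Δ + (sizes B + (sum (map (suc ∘ size) D) + sum (map sequentSize Hs))))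

sizes-++ : ∀ Γ Δ → sizes (Γ ++ Δ) ≡ sizes Γ + sizes Δ
sizes-++ Γ Δ = trans (cong sum (map-++ size Γ Δ)) (sum-++ (map size Γ) (map size Δ))

∈⇒size≤ : ∀ {D} → φ ∈ D → suc (size φ) ≤ sum (map (suc ∘ size) D)
∈⇒size≤ (here refl)       = m≤m+n _ _
∈⇒size≤ (there {x = ψ} i) = ≤-trans (∈⇒size≤ i) (m≤n+m _ (suc (size ψ)))

-- Backward proof search.

-- `Γ` and `Δ` are still to be decomposed; the other four lists accumulate what is left of them. The
-- left side is emptied first, though `∼` on the right can refill it.
search : ∀ Γ Δ A B C D Hs → Acc _<_ (weight Γ Δ B D Hs) →
         Result (Γ ++ literals A B ⇒ Δ ++ literals C D) Hs
search (var p ∷ Γ) Δ A B C D Hs (acc rs) =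
  permute (var-shift Γ A B) ↭-refl (search Γ Δ (p ∷ A) B C D Hs (rs ≤-refl))
search (∼ φ ∷ Γ) Δ A B C D Hs (acc rs) =
  ∼ˡ (search Γ (φ ∷ Δ) A B C D Hs (rs (≤-reflexive (eq (size φ) (sizes Γ) (sizes Δ) _))))
  where
  eq : ∀ a g d r → suc (g + (a + d + r)) ≡ suc (a + g + (d + r))
  eq = solve-∀
search (φ ∧ ψ ∷ Γ) Δ A B C D Hs (acc rs) =
  ∧ˡ (search (φ ∷ ψ ∷ Γ) Δ A B C D Hs (rs (≤-reflexive (eq (size φ) (size ψ) (sizes Γ) _))))
  where
  eq : ∀ a b g r → suc (a + (b + g) + r) ≡ suc (a + b + g + r)
  eq = solve-∀
search (□ φ ∷ Γ) Δ A B C D Hs (acc rs) =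
  permute (shift (□ φ) Γ (literals A B)) ↭-refl
    (search Γ Δ A (φ ∷ B) C D Hs
      -- On the left, unboxing loses two units, one more than required.
      (rs (≤-trans (≤-reflexive (eq (size φ) (sizes Γ) (sizes Δ) (sizes B) _)) (n≤1+n _))))
  where
  eq : ∀ a g d b r → suc (g + (d + (a + b + r))) ≡ suc (a + g + (d + (b + r)))
  eq = solve-∀
search [] (var p ∷ Δ) A B C D Hs (acc rs) =
  permute ↭-refl (var-shift Δ C D) (search [] Δ A B (p ∷ C) D Hs (rs ≤-refl))
search [] (∼ φ ∷ Δ) A B C D Hs (acc rs) =
  ∼ʳ (search (φ ∷ []) Δ A B C D Hs (rs (≤-reflexive (eq (size φ) (sizes Δ) _))))
  where
  eq : ∀ a d r → suc (a + 0 + (d + r)) ≡ suc (a + d + r)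
  eq = solve-∀
search [] (φ ∧ ψ ∷ Δ) A B C D Hs (acc rs) =
  ∧ʳ (search [] (φ ∷ Δ) A B C D Hs (rs (s≤s (mono (m≤m+n (size φ) (size ψ))))))
     (search [] (ψ ∷ Δ) A B C D Hs (rs (s≤s (mono (m≤n+m (size ψ) (size φ))))))
  where
  mono : ∀ {a b d r} → a ≤ b → a + d + r ≤ b + d + r
  mono {d = d} {r} a≤b = +-monoˡ-≤ r (+-monoˡ-≤ d a≤b)
search [] (□ φ ∷ Δ) A B C D Hs (acc rs) =
  permute ↭-refl (shift (□ φ) Δ (literals C D))
    (search [] Δ A B C (φ ∷ D) Hs
      (rs (≤-reflexive (eq (size φ) (sizes Δ) (sizes B) (sum (map (suc ∘ size) D)) _))))
  where
  eq : ∀ a d b e r → suc (d + (b + (suc a + e + r))) ≡ suc (suc a) + d + (b + (e + r))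
  eq = solve-∀
search [] [] A B C D Hs (acc rs) = modal A B C D Hs succ (next Hs rs)
  where
  e = sum (map (suc ∘ size) D)

  succ : φ ∈ D → Result (B ⇒ φ ∷ []) []
  succ {φ} i = drop-++[] (search B (φ ∷ []) [] [] [] [] [] (rs lighter))
    where
    open ≤-Reasoning

    eq : ∀ b a → suc (b + (a + 0 + 0)) ≡ b + suc a
    eq = solve-∀

    lighter : weight B (φ ∷ []) [] [] [] < weight [] [] B D Hs
    lighter = begin
      suc (sizes B + (size φ + 0 + 0)) ≡⟨ eq (sizes B) (size φ) ⟩
      sizes B + suc (size φ)           ≤⟨ +-monoʳ-≤ (sizes B) (≤-trans (∈⇒size≤ i) (m≤m+n e _)) ⟩
      weight [] [] B D Hs              ∎

  -- The accessibility function is passed along so that its bound is refined when `Hs` is split.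
  next : ∀ Hs → (∀ {n} → n < weight [] [] B D Hs → Acc _<_ n) → Next B Hs
  next []             rs = tt
  next ((Γ ⇒ Δ) ∷ Hs) rs = drop-++[] (search (B ++ Γ) Δ [] [] [] [] Hs (rs lighter))
    where
    open ≤-Reasoning

    eq : ∀ b g d s → suc (b + g + (d + s)) ≡ b + (suc (g + d) + s)
    eq = solve-∀

    s = sum (map sequentSize Hs)

    lighter : weight (B ++ Γ) Δ [] [] Hs < weight [] [] B D ((Γ ⇒ Δ) ∷ Hs)
    lighter = begin
      suc (sizes (B ++ Γ) + (sizes Δ + s))        ≡⟨ cong (λ n → suc (n + (sizes Δ + s))) (sizes-++ B Γ) ⟩
      suc (sizes B + sizes Γ + (sizes Δ + s))     ≡⟨ eq (sizes B) (sizes Γ) (sizes Δ) s ⟩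
      sizes B + (suc (sizes Γ + sizes Δ) + s)     ≤⟨ +-monoʳ-≤ (sizes B) (m≤n+m _ e) ⟩
      weight [] [] B D ((Γ ⇒ Δ) ∷ Hs)             ∎

corollary25 : (H : Hypersequent) → ValidIn U H → Σ[ d ∈ RK H ] CutFree d
corollary25 ((Γ ⇒ Δ) ∷ Hs) valid =
  Sum.[ id , (λ ce → contradiction ce (valid treeModel tt)) ]′
    (drop-++[] (search Γ Δ [] [] [] [] Hs (<-wellFounded _)))
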